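{- There is an interpretation of $L(I)$ in $W(I)$, for which the co-ordinate map from the set of finite unions of closed intervals of $I$ to (finite subsets of $I$)$^2$ is given by $A \mapsto (l(A),r(A))$, the pair consisting of the set of left endpoints and the set of right endpoints of $A$.
   Context: Let $I$ be a dense linear order with a left endpoint $0$ and no right endpoint. $W(I)$ is the structure in the signature $\{\cup,\cap,\bot,\{0\},\min,\max,\mathrm{ips}\}$ whose universe is the collection of finite subsets of $I$, with $\cup,\cap$ union and intersection, $\bot$ the empty set, the constant $\{0\}$ interpreted as the singleton of the left endpoint, $\min$ and $\max$ sending a nonempty finite set to the singleton of its minimum (resp. maximum) and fixing $\emptyset$, and $\mathrm{ips}$ the binary function $\mathrm{ips}(A,B)=\{i\in A : \text{the successor of } i \text{ in } A \text{ (in the induced order) exists and lies in } B\}$. $L(I)$ is the structure in the signature $\{\cup,\cap,\bot,\{0\},\min,\max,l,r\}$ whose universe is the collection of finite unions of closed intervals of $I$ (closed intervals being sets of the form $[i,j]$, $[i,+\infty)$, $(-\infty,j]$), with $\cup,\cap$ union and intersection, $\bot$ the empty set, $\{0\}$ the singleton of the left endpoint, $\min$ and $\max$ sending a set to the singleton of its minimum (resp. maximum), with $\min(\emptyset)=\max(\emptyset)=\emptyset$ and $\max(A)=\emptyset$ for unbounded $A$, and $l$, $r$ sending a set to the set of its left (resp. right) endpoints. -}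

module Defs where

open import Data.Empty using (⊥; ⊥-elim)
open import Data.Fin.Base using (Fin)
open import Data.Fin.Patterns using (0F; 1F)
open import Data.List.Base using (List; []; _∷_; _++_; map; concatMap; filter; cartesianProductWith)
import Data.List.Membership.DecSetoid as DecMembership
import Data.List.Membership.Setoid.Properties as Membershipₚ
open import Data.List.Relation.Unary.All as All using (All; []; _∷_; all?)
open import Data.List.Relation.Unary.Any as Any using (Any; here; there; any?)
import Data.List.Relation.Unary.Any.Properties as Anyₚ
open import Data.Maybe.Base using (Maybe; maybe′)
open import Data.Nat.Base using (ℕ; suc)
open import Data.Product.Base as Product using (∃; ∃-syntax; _×_; _,_; proj₁; proj₂)
open import Data.Sum.Base as Sum using (_⊎_; inj₁; inj₂)
open import Data.Vec.Functional as Vector using (Vector)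
open import Function.Base using (_∘_; id)
open import Function.Bundles using (_⇔_)
open import Level using (Lift; _⊔_) renaming (suc to lsuc)
open import Relation.Binary.Bundles using (Setoid; DenseLinearOrder; DecTotalOrder)
import Relation.Binary.Construct.On as On
open import Relation.Binary.Definitions using (Minimum; Maximum; _Respects_)
import Relation.Binary.Properties.StrictTotalOrder as StrictTotalOrderₚ
open import Relation.Nullary using (¬_; Dec; yes; no; contradiction)
open import Relation.Nullary.Decidable using (map′; _×-dec_; _→-dec_)
open import Relation.Unary using (Pred; Decidable; _∈_; _∩_; _∪_; _⊆_; _≐_; ∅)
open import Relation.Unary.Properties using (≐-sym)
open import Relation.Unary.Relation.Binary.Equality using (≐-setoid)
import Algebra.Construct.NaturalChoice.Max as Max
import Algebra.Construct.NaturalChoice.Min as Min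

-- Both signatures considered here are purely functional, so relation
-- symbols are left out.

record Signature : Set₁ where
  field
    Symbol : Set
    arity  : Symbol → ℕ

open Signature public

record Structure (Ω : Signature) a ℓ : Set (lsuc (a ⊔ ℓ)) where
  field
    setoid : Setoid a ℓ

  open Setoid setoid public using (Carrier; _≈_)

  field
    op      : (f : Symbol Ω) → Vector Carrier (arity Ω f) → Carrier
    op-cong : ∀ f {xs ys} → (∀ i → xs i ≈ ys i) → op f xs ≈ op f ys

data Term (Ω : Signature) (V : Set) : Set where
  var : V → Term Ω V
  app : (f : Symbol Ω) → Vector (Term Ω V) (arity Ω f) → Term Ω V

infix  8 _≋_
infixr 7 _∧_
infixr 6 _∨_
infixr 5 _⇒_

-- Formulas with free variables in V; a quantifier binds the variable
-- nothing of Maybe V.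

data Formula (Ω : Signature) (V : Set) : Set where
  _≋_         : Term Ω V → Term Ω V → Formula Ω V
  falsum      : Formula Ω V
  _∧_ _∨_ _⇒_ : Formula Ω V → Formula Ω V → Formula Ω V
  forAll      : Formula Ω (Maybe V) → Formula Ω V
  exists      : Formula Ω (Maybe V) → Formula Ω V

module _ {Ω : Signature} {a ℓ} (A : Structure Ω a ℓ) where
  open Structure A

  eval : {V : Set} → (V → Carrier) → Term Ω V → Carrier
  eval ρ (var x)    = ρ x
  eval ρ (app f ts) = op f (λ i → eval ρ (ts i))

  infix 4 _⊨_

  _⊨_ : {V : Set} → (V → Carrier) → Formula Ω V → Set (a ⊔ ℓ)
  ρ ⊨ s ≋ t    = Lift a (eval ρ s ≈ eval ρ t)
  ρ ⊨ falsum   = Lift (a ⊔ ℓ) ⊥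
  ρ ⊨ φ ∧ ψ    = (ρ ⊨ φ) × (ρ ⊨ ψ)
  ρ ⊨ φ ∨ ψ    = (ρ ⊨ φ) ⊎ (ρ ⊨ ψ)
  ρ ⊨ φ ⇒ ψ    = ρ ⊨ φ → ρ ⊨ ψ
  ρ ⊨ forAll φ = ∀ x → maybe′ ρ x ⊨ φ
  ρ ⊨ exists φ = ∃[ x ] maybe′ ρ x ⊨ φ

-- A (parameter-free, n-dimensional) interpretation of B in A whose
-- co-ordinate map is the given injection of B into Aⁿ.  A formula of A
-- defines the image, and for each unnested atomic formula of B, namely
-- x₀ = x₁ or f(x₁,…,xₖ) = x₀, a formula of A defines the relation
-- induced on the image.  The variable (j , i) stands for the i-th
-- co-ordinate of xⱼ.  The surjection from the domain onto B used in the
-- usual definition is the inverse of coord.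

record Interpretation
  {Ω Ω′ : Signature} {b ℓᵇ a ℓᵃ n}
  (B : Structure Ω b ℓᵇ) (A : Structure Ω′ a ℓᵃ)
  (coord : Structure.Carrier B → Vector (Structure.Carrier A) n)
  : Set (b ⊔ ℓᵇ ⊔ a ⊔ ℓᵃ) where

  private
    module A = Structure A
    module B = Structure B

  coords : ∀ {k} → Vector B.Carrier k → Fin k × Fin n → A.Carrier
  coords xs (j , i) = coord (xs j) i

  field
    coord-cong      : ∀ {x y} → x B.≈ y → ∀ i → coord x i A.≈ coord y i
    coord-injective : ∀ {x y} → (∀ i → coord x i A.≈ coord y i) → x B.≈ y

    domain   : Formula Ω′ (Fin n)
    domain-⊨ : ∀ as → _⊨_ A as domain ⇔ (∃[ x ] ∀ i → coord x i A.≈ as i)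

    equality   : Formula Ω′ (Fin 2 × Fin n)
    equality-⊨ : ∀ xs → _⊨_ A (coords xs) equality ⇔ (xs 0F B.≈ xs 1F)

    graph   : ∀ f → Formula Ω′ (Fin (suc (arity Ω f)) × Fin n)
    graph-⊨ : ∀ f x₀ xs →
              _⊨_ A (coords (x₀ Vector.∷ xs)) (graph f) ⇔ (B.op f xs B.≈ x₀)

record LeftEndpointDLO c ℓ₁ ℓ₂ : Set (lsuc (c ⊔ ℓ₁ ⊔ ℓ₂)) where
  field
    denseLinearOrder : DenseLinearOrder c ℓ₁ ℓ₂

  open DenseLinearOrder denseLinearOrder public
  open StrictTotalOrderₚ strictTotalOrder public
    using (_≤_; _≤?_; decTotalOrder)

  field
    0#         : Carrier
    0#-minimum : Minimum _≤_ 0#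
    no-maximum : ∀ m → ¬ Maximum _≤_ m

-- origin stands for the constant {0}.

data SymbolW : Set where
  union inter empty origin min max ips : SymbolW

-- left and right stand for l and r.

data SymbolL : Set where
  union inter empty origin min max left right : SymbolL

signatureW : Signature
signatureW = record { Symbol = SymbolW ; arity = arityW }
  where
  arityW : SymbolW → ℕ
  arityW union  = 2
  arityW inter  = 2
  arityW empty  = 0
  arityW origin = 0
  arityW min    = 1
  arityW max    = 1
  arityW ips    = 2

signatureL : Signature
signatureL = record { Symbol = SymbolL ; arity = arityL }
  where
  arityL : SymbolL → ℕ
  arityL union  = 2
  arityL inter  = 2
  arityL empty  = 0
  arityL origin = 0
  arityL min    = 1
  arityL max    = 1
  arityL left   = 1
  arityL right  = 1

module _ {c ℓ₁ ℓ₂} (I : LeftEndpointDLO c ℓ₁ ℓ₂) where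

  open LeftEndpointDLO I hiding (trans; irrefl)
  private
    module < = LeftEndpointDLO I
    module ≤ = DecTotalOrder decTotalOrder
    module ⊔ = Max ≤.totalOrder
    module ⊓ = Min ≤.totalOrder

  Singleton : Carrier → Pred Carrier ℓ₁
  Singleton i x = x ≈ i

  Least : ∀ {p} → Pred Carrier p → Pred Carrier _
  Least P x = x ∈ P × (∀ y → y ∈ P → x ≤ y)

  Greatest : ∀ {p} → Pred Carrier p → Pred Carrier _
  Greatest P x = x ∈ P × (∀ y → y ∈ P → y ≤ x)

  Successor : ∀ {p} → Pred Carrier p → Carrier → Pred Carrier _
  Successor P i = Least (P ∩ (i <_))

  Ips : ∀ {p} → Pred Carrier p → Pred Carrier p → Pred Carrier _
  Ips P Q i = i ∈ P × ∃[ j ] (Successor P i j × j ∈ Q)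

  -- x is the left (right) endpoint of its convex component in P.  The
  -- convex components of a finite union of closed intervals are the
  -- intervals of its unique decomposition into finitely many pairwise
  -- disjoint closed intervals; a component {x} has both endpoints x.

  LeftEndpoint : ∀ {p} → Pred Carrier p → Pred Carrier _
  LeftEndpoint P x =
    x ∈ P × (∀ y → y < x → ¬ (∀ z → y ≤ z → z ≤ x → z ∈ P))

  RightEndpoint : ∀ {p} → Pred Carrier p → Pred Carrier _
  RightEndpoint P x =
    x ∈ P × (∀ y → x < y → ¬ (∀ z → x ≤ z → z ≤ y → z ∈ P))

  private
    module _ {p q} {P : Pred Carrier p} {Q : Pred Carrier q} where

      Least-mono : P ≐ Q → Least P ⊆ Least Q
      Least-mono (f , g) (x∈P , lb) = f x∈P , λ y → lb y ∘ g

      Greatest-mono : P ≐ Q → Greatest P ⊆ Greatest Q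
      Greatest-mono (f , g) (x∈P , ub) = f x∈P , λ y → ub y ∘ g

      Left-mono : P ≐ Q → LeftEndpoint P ⊆ LeftEndpoint Q
      Left-mono (f , g) (x∈P , e) =
        f x∈P , λ y y<x h → e y y<x (λ z u v → g (h z u v))

      Right-mono : P ≐ Q → RightEndpoint P ⊆ RightEndpoint Q
      Right-mono (f , g) (x∈P , e) =
        f x∈P , λ y x<y h → e y x<y (λ z u v → g (h z u v))

    module _ {p} {P P′ Q Q′ : Pred Carrier p} where

      ∪-mono : P ≐ P′ → Q ≐ Q′ → (P ∪ Q) ⊆ (P′ ∪ Q′)
      ∪-mono (f , _) (g , _) = Sum.map f g

      ∩-mono : P ≐ P′ → Q ≐ Q′ → (P ∩ Q) ⊆ (P′ ∩ Q′)
      ∩-mono (f , _) (g , _) = Product.map f g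

      Ips-mono : P ≐ P′ → Q ≐ Q′ → Ips P Q ⊆ Ips P′ Q′
      Ips-mono (f , f′) (g , _) (i∈P , j , ((j∈P , i<j) , lb) , j∈Q) =
        f i∈P , j , ((f j∈P , i<j) , λ k (k∈P , i<k) → lb k (f′ k∈P , i<k)) , g j∈Q

    <-≤-trans : ∀ {x y z} → x < y → y ≤ z → x < z
    <-≤-trans x<y (inj₁ y<z) = <.trans x<y y<z
    <-≤-trans x<y (inj₂ y≈z) = <.<-respʳ-≈ y≈z x<y

    ≤-<-trans : ∀ {x y z} → x ≤ y → y < z → x < z
    ≤-<-trans (inj₁ x<y) y<z = <.trans x<y y<z
    ≤-<-trans (inj₂ x≈y) y<z = <.<-respˡ-≈ (Eq.sym x≈y) y<z

    <-irr : ∀ {x} → ¬ (x < x)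
    <-irr = <.irrefl Eq.refl

    ≰⇒> : ∀ {x y} → ¬ (x ≤ y) → y < x
    ≰⇒> {x} {y} x≰y with ≤.total x y
    ... | inj₁ x≤y        = contradiction x≤y x≰y
    ... | inj₂ (inj₁ y<x) = y<x
    ... | inj₂ (inj₂ y≈x) = contradiction (inj₂ (Eq.sym y≈x)) x≰y

    ≮⇒≥ : ∀ {x y} → ¬ (x < y) → y ≤ x
    ≮⇒≥ {x} {y} x≮y with ≤.total y x
    ... | inj₁ y≤x        = y≤x
    ... | inj₂ (inj₁ x<y) = contradiction x<y x≮y
    ... | inj₂ (inj₂ x≈y) = inj₂ (Eq.sym x≈y)

    ≤⇒≯ : ∀ {x y} → x ≤ y → ¬ (y < x)
    ≤⇒≯ x≤y y<x = <-irr (≤-<-trans x≤y y<x)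

  -- A finite subset is given by a list of its elements, and two lists
  -- are identified when they have the same elements.

  FinSet : Set c
  FinSet = List Carrier

  open DecMembership Eq.decSetoid using ()
    renaming (_∈_ to _∈ʷ_; _∈?_ to _∈ʷ?_)

  ⟦_⟧ʷ : FinSet → Pred Carrier (c ⊔ ℓ₁)
  ⟦ A ⟧ʷ x = x ∈ʷ A

  setoidW : Setoid c (c ⊔ ℓ₁)
  setoidW = On.setoid (≐-setoid Carrier _) ⟦_⟧ʷ

  private
    respʷ : ∀ A → ⟦ A ⟧ʷ Respects _≈_
    respʷ A = Membershipₚ.∈-resp-≈ Eq.setoid

    all∈? : ∀ {p} {P : Pred Carrier p} → Decidable P → P Respects _≈_ →
            ∀ A → Dec (∀ y → y ∈ ⟦ A ⟧ʷ → P y)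
    all∈? P? resp A =
      map′ (λ ps y → All.lookupₛ Eq.setoid resp ps)
           (λ h → All.tabulateₛ Eq.setoid (h _))
           (all? P? A)

    collect : ∀ {p} {P : Pred Carrier p} → Decidable P → P Respects _≈_ →
              ∀ A → P ⊆ ⟦ A ⟧ʷ → ∃[ S ] ⟦ S ⟧ʷ ≐ P
    collect P? resp A P⊆A =
      filter P? A ,
      proj₂ ∘ Membershipₚ.∈-filter⁻ Eq.setoid P? resp {xs = A} ,
      λ p → Membershipₚ.∈-filter⁺ Eq.setoid P? resp (P⊆A p) p

    Least-resp : ∀ {p} {P : Pred Carrier p} → P Respects _≈_ →
                 Least P Respects _≈_
    Least-resp resp x≈y (x∈P , lb) =
      resp x≈y x∈P , λ z z∈P → ≤.≤-respˡ-≈ x≈y (lb z z∈P)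

    Greatest-resp : ∀ {p} {P : Pred Carrier p} → P Respects _≈_ →
                    Greatest P Respects _≈_
    Greatest-resp resp x≈y (x∈P , ub) =
      resp x≈y x∈P , λ z z∈P → ≤.≤-respʳ-≈ x≈y (ub z z∈P)

    Ips-resp : ∀ {p} {P Q : Pred Carrier p} → P Respects _≈_ →
               Ips P Q Respects _≈_
    Ips-resp resp x≈y (x∈P , j , ((j∈P , x<j) , lb) , j∈Q) =
      resp x≈y x∈P , j ,
      ((j∈P , <.<-respˡ-≈ x≈y x<j) ,
       λ k (k∈P , y<k) → lb k (k∈P , <.<-respˡ-≈ (Eq.sym x≈y) y<k)) ,
      j∈Q

    Successor? : ∀ A i → Decidable (Successor ⟦ A ⟧ʷ i)
    Successor? A i j =
      ((j ∈ʷ? A) ×-dec (i <? j)) ×-dec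
      map′ (λ h y (y∈A , i<y) → h y y∈A i<y) (λ h y y∈A i<y → h y (y∈A , i<y))
        (all∈? (λ k → (i <? k) →-dec (j ≤? k))
          (λ k≈k′ h i<k′ → ≤.≤-respʳ-≈ k≈k′ (h (<.<-respʳ-≈ (Eq.sym k≈k′) i<k′)))
          A)

    Ips? : ∀ A B → Decidable (Ips ⟦ A ⟧ʷ ⟦ B ⟧ʷ)
    Ips? A B i = (i ∈ʷ? A) ×-dec
      map′ (λ a → let j , _ , p = find a in j , p)
           (λ (j , (s , j∈B)) → lose resp (proj₁ (proj₁ s)) (s , j∈B))
           (any? (λ j → Successor? A i j ×-dec (j ∈ʷ? B)) A)
      where
      open DecMembership Eq.decSetoid using (find; lose)
      resp : (λ j → Successor ⟦ A ⟧ʷ i j × j ∈ ⟦ B ⟧ʷ) Respects _≈_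
      resp j≈k (s , j∈B) =
        Least-resp (λ e (u , v) → respʷ A e u , <.<-respʳ-≈ e v) j≈k s ,
        respʷ B j≈k j∈B

  -- Each operation is given together with a proof that it has the
  -- intended elements, which determines it up to the equality above.

  unionW : ∀ A B → ∃[ S ] ⟦ S ⟧ʷ ≐ ⟦ A ⟧ʷ ∪ ⟦ B ⟧ʷ
  unionW A B = A ++ B , Anyₚ.++⁻ A , Sum.[ Anyₚ.++⁺ˡ , Anyₚ.++⁺ʳ A ]

  interW : ∀ A B → ∃[ S ] ⟦ S ⟧ʷ ≐ ⟦ A ⟧ʷ ∩ ⟦ B ⟧ʷ
  interW A B = collect (λ x → (x ∈ʷ? A) ×-dec (x ∈ʷ? B))
    (λ e (u , v) → respʷ A e u , respʷ B e v) A proj₁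

  emptyW : ∃[ S ] ⟦ S ⟧ʷ ≐ ∅
  emptyW = [] , (λ ()) , λ ()

  originW : ∃[ S ] ⟦ S ⟧ʷ ≐ Singleton 0#
  originW = 0# ∷ [] , (λ { (here e) → e }) , here

  minW : ∀ A → ∃[ S ] ⟦ S ⟧ʷ ≐ Least ⟦ A ⟧ʷ
  minW A = collect
    (λ x → (x ∈ʷ? A) ×-dec all∈? (x ≤?_) ≤.≤-respʳ-≈ A)
    (Least-resp (respʷ A)) A proj₁

  maxW : ∀ A → ∃[ S ] ⟦ S ⟧ʷ ≐ Greatest ⟦ A ⟧ʷ
  maxW A = collect
    (λ x → (x ∈ʷ? A) ×-dec all∈? (_≤? x) ≤.≤-respˡ-≈ A)
    (Greatest-resp (respʷ A)) A proj₁

  ipsW : ∀ A B → ∃[ S ] ⟦ S ⟧ʷ ≐ Ips ⟦ A ⟧ʷ ⟦ B ⟧ʷ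
  ipsW A B = collect (Ips? A B) (Ips-resp {Q = ⟦ B ⟧ʷ} (respʷ A)) A proj₁

  private
    lift≐ : ∀ {p q r s}
            {S : Pred Carrier p} {P : Pred Carrier q}
            {T : Pred Carrier r} {Q : Pred Carrier s} →
            S ≐ P → T ≐ Q → P ⊆ Q → Q ⊆ P → S ≐ T
    lift≐ (f , f′) (g , g′) h h′ = g′ ∘ h ∘ f , f′ ∘ h′ ∘ g

  W : Structure signatureW c (c ⊔ ℓ₁)
  W = record { setoid = setoidW ; op = op ; op-cong = op-cong }
    where
    open Setoid setoidW using () renaming (_≈_ to _≈ʷ_)

    op : ∀ f → Vector FinSet (arity signatureW f) → FinSet
    op union  A = proj₁ (unionW (A 0F) (A 1F))
    op inter  A = proj₁ (interW (A 0F) (A 1F))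
    op empty  A = proj₁ emptyW
    op origin A = proj₁ originW
    op min    A = proj₁ (minW (A 0F))
    op max    A = proj₁ (maxW (A 0F))
    op ips    A = proj₁ (ipsW (A 0F) (A 1F))

    op-cong : ∀ f {A B : Vector FinSet (arity signatureW f)} →
              (∀ i → A i ≈ʷ B i) → op f A ≈ʷ op f B
    op-cong union {A} {B} e =
      lift≐ (proj₂ (unionW (A 0F) (A 1F))) (proj₂ (unionW (B 0F) (B 1F)))
        (∪-mono (e 0F) (e 1F)) (∪-mono (≐-sym (e 0F)) (≐-sym (e 1F)))
    op-cong inter {A} {B} e =
      lift≐ (proj₂ (interW (A 0F) (A 1F))) (proj₂ (interW (B 0F) (B 1F)))
        (∩-mono (e 0F) (e 1F)) (∩-mono (≐-sym (e 0F)) (≐-sym (e 1F)))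
    op-cong empty  e = id , id
    op-cong origin e = id , id
    op-cong min {A} {B} e = lift≐ (proj₂ (minW (A 0F))) (proj₂ (minW (B 0F)))
      (Least-mono (e 0F)) (Least-mono (≐-sym (e 0F)))
    op-cong max {A} {B} e = lift≐ (proj₂ (maxW (A 0F))) (proj₂ (maxW (B 0F)))
      (Greatest-mono (e 0F)) (Greatest-mono (≐-sym (e 0F)))
    op-cong ips {A} {B} e =
      lift≐ (proj₂ (ipsW (A 0F) (A 1F))) (proj₂ (ipsW (B 0F) (B 1F)))
        (Ips-mono (e 0F) (e 1F)) (Ips-mono (≐-sym (e 0F)) (≐-sym (e 1F)))

  -- [ i , j ] with j < i is the empty set, which is in any case the
  -- empty union.

  data ClosedInterval : Set c where
    [_,_]  : Carrier → Carrier → ClosedInterval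
    [_,+∞⟩ : Carrier → ClosedInterval
    ⟨-∞,_] : Carrier → ClosedInterval

  ⟦_⟧ⁱ : ClosedInterval → Pred Carrier (ℓ₁ ⊔ ℓ₂)
  ⟦ [ i , j ]  ⟧ⁱ x = i ≤ x × x ≤ j
  ⟦ [ i ,+∞⟩   ⟧ⁱ x = i ≤ x
  ⟦ ⟨-∞, j ]   ⟧ⁱ x = x ≤ j

  -- A list of closed intervals represents their union, and two lists
  -- are identified when they have the same union.

  IntervalUnion : Set c
  IntervalUnion = List ClosedInterval

  ⟦_⟧ˡ : IntervalUnion → Pred Carrier (c ⊔ ℓ₁ ⊔ ℓ₂)
  ⟦ A ⟧ˡ x = Any (λ J → x ∈ ⟦ J ⟧ⁱ) A

  setoidL : Setoid c (c ⊔ ℓ₁ ⊔ ℓ₂)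
  setoidL = On.setoid (≐-setoid Carrier _) ⟦_⟧ˡ

  private
    _∈ⁱ?_ : ∀ x J → Dec (x ∈ ⟦ J ⟧ⁱ)
    x ∈ⁱ? [ i , j ] = (i ≤? x) ×-dec (x ≤? j)
    x ∈ⁱ? [ i ,+∞⟩  = i ≤? x
    x ∈ⁱ? ⟨-∞, j ]  = x ≤? j

    _∈ᴸ?_ : ∀ x A → Dec (x ∈ ⟦ A ⟧ˡ)
    x ∈ᴸ? A = any? (x ∈ⁱ?_) A

    respⁱ : ∀ J → ⟦ J ⟧ⁱ Respects _≈_
    respⁱ [ i , j ] e (u , v) = ≤.≤-respʳ-≈ e u , ≤.≤-respˡ-≈ e v
    respⁱ [ i ,+∞⟩  e u       = ≤.≤-respʳ-≈ e u
    respⁱ ⟨-∞, j ]  e v       = ≤.≤-respˡ-≈ e v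

    respᴸ : ∀ A → ⟦ A ⟧ˡ Respects _≈_
    respᴸ A e = Any.map (λ {J} → respⁱ J e)

    tabulateᴸ : ∀ {p} {P : Pred ClosedInterval p} A →
                (∀ J → ⟦ J ⟧ⁱ ⊆ ⟦ A ⟧ˡ → P J) → All P A
    tabulateᴸ []      h = []
    tabulateᴸ (J ∷ A) h = h J here ∷ tabulateᴸ A (λ K K⊆A → h K (there ∘ K⊆A))

    lookupᴸ : ∀ {p q} {P : Pred ClosedInterval p} {Q : Set q} {A x} →
              All P A → x ∈ ⟦ A ⟧ˡ → (∀ J → P J → x ∈ ⟦ J ⟧ⁱ → Q) → Q
    lookupᴸ (p ∷ _)  (here x∈J) h = h _ p x∈J
    lookupᴸ (_ ∷ ps) (there a)  h = lookupᴸ ps a h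

    lower : ClosedInterval → Carrier
    lower [ i , j ] = i
    lower [ i ,+∞⟩  = i
    lower ⟨-∞, j ]  = 0#

    lower-≤ : ∀ J {x} → x ∈ ⟦ J ⟧ⁱ → lower J ≤ x
    lower-≤ [ i , j ] = proj₁
    lower-≤ [ i ,+∞⟩  = id
    lower-≤ ⟨-∞, j ]  = λ _ → 0#-minimum _

    down : ∀ J {x z} → x ∈ ⟦ J ⟧ⁱ → lower J ≤ z → z ≤ x → z ∈ ⟦ J ⟧ⁱ
    down [ i , j ] (_ , x≤j) i≤z z≤x = i≤z , ≤.trans z≤x x≤j
    down [ i ,+∞⟩  _         i≤z z≤x = i≤z
    down ⟨-∞, j ]  x≤j       _   z≤x = ≤.trans z≤x x≤j

    uppers : ClosedInterval → List Carrier
    uppers [ i , j ] = j ∷ []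
    uppers [ i ,+∞⟩  = []
    uppers ⟨-∞, j ]  = j ∷ []

    lowers-∈ : ∀ A {x} → x ∈ ⟦ A ⟧ˡ →
               (∀ J → ⟦ J ⟧ⁱ ⊆ ⟦ A ⟧ˡ → x ∈ ⟦ J ⟧ⁱ → x ≤ lower J) →
               x ∈ ⟦ map lower A ⟧ʷ
    lowers-∈ (J ∷ A) (here x∈J) h = here (≤.antisym (h J here x∈J) (lower-≤ J x∈J))
    lowers-∈ (J ∷ A) (there a)  h = there (lowers-∈ A a (λ K K⊆A → h K (there ∘ K⊆A)))

    -- x is at least the right end of J, which exists
    Above : ClosedInterval → Carrier → Set (c ⊔ ℓ₁ ⊔ ℓ₂)
    Above J x = Any (_≤ x) (uppers J)

    above-∈ : ∀ J {x} → x ∈ ⟦ J ⟧ⁱ → Above J x → x ∈ ⟦ uppers J ⟧ʷ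
    above-∈ [ i , j ] (_ , x≤j) (here j≤x) = here (≤.antisym x≤j j≤x)
    above-∈ ⟨-∞, j ]  x≤j       (here j≤x) = here (≤.antisym x≤j j≤x)

    above-≥ : ∀ J {x} → Above J x → ∀ y → y ∈ ⟦ J ⟧ⁱ → y ≤ x
    above-≥ [ i , j ] (here j≤x) y (_ , y≤j) = ≤.trans y≤j j≤x
    above-≥ ⟨-∞, j ]  (here j≤x) y y≤j       = ≤.trans y≤j j≤x

    above-resp : ∀ J {x y} → x ≈ y → Above J x → Above J y
    above-resp J x≈y = Any.map (≤.≤-respʳ-≈ x≈y)

    uppers-∈ : ∀ A {x} → x ∈ ⟦ A ⟧ˡ →
               (∀ J → ⟦ J ⟧ⁱ ⊆ ⟦ A ⟧ˡ → x ∈ ⟦ J ⟧ⁱ → Above J x) →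
               x ∈ ⟦ concatMap uppers A ⟧ʷ
    uppers-∈ (J ∷ A) (here x∈J) h = Anyₚ.++⁺ˡ (above-∈ J x∈J (h J here x∈J))
    uppers-∈ (J ∷ A) (there a)  h =
      Anyₚ.++⁺ʳ (uppers J) (uppers-∈ A a (λ K K⊆A → h K (there ∘ K⊆A)))

    least? : ∀ A x → Dec (Least ⟦ A ⟧ˡ x)
    least? A x = (x ∈ᴸ? A) ×-dec
      map′ (λ ps y y∈A → lookupᴸ ps y∈A λ J p y∈J →
              ≤.trans (p (down J y∈J ≤.refl (lower-≤ J y∈J))) (lower-≤ J y∈J))
           (λ h → tabulateᴸ A (λ J J⊆A m → h _ (J⊆A m)))
           (all? (λ J → (lower J ∈ⁱ? J) →-dec (x ≤? lower J)) A)

    bounded⇒above : ∀ J {x y} → y ∈ ⟦ J ⟧ⁱ → (∀ z → z ∈ ⟦ J ⟧ⁱ → z ≤ x) → Above J x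
    bounded⇒above [ i , j ] (i≤y , y≤j) h = here (h j (≤.trans i≤y y≤j , ≤.refl))
    bounded⇒above [ i ,+∞⟩  i≤y         h = ⊥-elim (no-maximum _ λ z →
      Sum.[ h z , (λ z≤i → ≤.trans z≤i (h i ≤.refl)) ]′ (≤.total i z))
    bounded⇒above ⟨-∞, j ]  y≤j         h = here (h j ≤.refl)

    greatest? : ∀ A x → Dec (Greatest ⟦ A ⟧ˡ x)
    greatest? A x = (x ∈ᴸ? A) ×-dec
      map′ (λ ps y y∈A → lookupᴸ ps y∈A λ J p y∈J →
              above-≥ J (p (down J y∈J ≤.refl (lower-≤ J y∈J))) y y∈J)
           (λ h → tabulateᴸ A (λ J J⊆A m →
              bounded⇒above J m (λ z z∈J → h z (J⊆A z∈J))))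
           (all? (λ J → (lower J ∈ⁱ? J) →-dec any? (_≤? x) (uppers J)) A)

    -- Points of A close enough to x on the left (right) lie only in
    -- intervals that contain x.

    leftGap : ∀ A {x y} → y < x → ∃[ m ] (y ≤ m × m < x ×
              All (λ J → ∀ z → m < z → z < x → z ∈ ⟦ J ⟧ⁱ → x ∈ ⟦ J ⟧ⁱ) A)
    leftGap []      y<x = _ , ≤.refl , y<x , []
    leftGap (J ∷ A) y<x =
      let m , y≤m , m<x , p  = one J y<x
          n , m≤n , n<x , ps = leftGap A m<x
      in n , ≤.trans y≤m m≤n , n<x , (λ z n<z → p z (≤-<-trans m≤n n<z)) ∷ ps
      where
      cut : ∀ {x y} j → y < x → ∃[ m ] (y ≤ m × m < x ×
            (∀ z → m < z → z < x → z ≤ j → x ≤ j))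
      cut {x} {y} j y<x with x ≤? j | ≤.total y j
      ... | yes x≤j | _        = y , ≤.refl , y<x , λ _ _ _ _ → x≤j
      ... | no  x≰j | inj₁ y≤j = j , y≤j , ≰⇒> x≰j , λ z j<z _ z≤j → ⊥-elim (≤⇒≯ z≤j j<z)
      ... | no  x≰j | inj₂ j≤y = y , ≤.refl , y<x , λ z y<z _ z≤j →
        ⊥-elim (≤⇒≯ (≤.trans z≤j j≤y) y<z)

      one : ∀ J {x y} → y < x → ∃[ m ] (y ≤ m × m < x ×
            (∀ z → m < z → z < x → z ∈ ⟦ J ⟧ⁱ → x ∈ ⟦ J ⟧ⁱ))
      one [ i , j ] y<x =
        let m , y≤m , m<x , f = cut j y<x
        in m , y≤m , m<x , λ z m<z z<x (i≤z , z≤j) →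
             ≤.trans i≤z (inj₁ z<x) , f z m<z z<x z≤j
      one [ i ,+∞⟩  y<x = _ , ≤.refl , y<x , λ z _ z<x i≤z → ≤.trans i≤z (inj₁ z<x)
      one ⟨-∞, j ]  y<x = cut j y<x

    rightGap : ∀ A {x y} → x < y → ∃[ m ] (m ≤ y × x < m ×
               All (λ J → ∀ z → x < z → z < m → z ∈ ⟦ J ⟧ⁱ → x ∈ ⟦ J ⟧ⁱ) A)
    rightGap []      x<y = _ , ≤.refl , x<y , []
    rightGap (J ∷ A) x<y =
      let m , m≤y , x<m , p  = one J x<y
          n , n≤m , x<n , ps = rightGap A x<m
      in n , ≤.trans n≤m m≤y , x<n , (λ z x<z z<n → p z x<z (<-≤-trans z<n n≤m)) ∷ ps
      where
      cut : ∀ {x y} i → x < y → ∃[ m ] (m ≤ y × x < m ×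
            (∀ z → x < z → z < m → i ≤ z → i ≤ x))
      cut {x} {y} i x<y with i ≤? x | ≤.total i y
      ... | yes i≤x | _        = y , ≤.refl , x<y , λ _ _ _ _ → i≤x
      ... | no  i≰x | inj₁ i≤y = i , i≤y , ≰⇒> i≰x , λ z _ z<i i≤z → ⊥-elim (≤⇒≯ i≤z z<i)
      ... | no  i≰x | inj₂ y≤i = y , ≤.refl , x<y , λ z _ z<y i≤z →
        ⊥-elim (≤⇒≯ (≤.trans y≤i i≤z) z<y)

      one : ∀ J {x y} → x < y → ∃[ m ] (m ≤ y × x < m ×
            (∀ z → x < z → z < m → z ∈ ⟦ J ⟧ⁱ → x ∈ ⟦ J ⟧ⁱ))
      one [ i , j ] x<y =
        let m , m≤y , x<m , f = cut i x<y
        in m , m≤y , x<m , λ z x<z z<m (i≤z , z≤j) →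
             f z x<z z<m i≤z , ≤.trans (inj₁ x<z) z≤j
      one [ i ,+∞⟩  x<y = cut i x<y
      one ⟨-∞, j ]  x<y = _ , ≤.refl , x<y , λ z x<z _ z≤j → ≤.trans (inj₁ x<z) z≤j

    left-≤lower : ∀ A {x} → LeftEndpoint ⟦ A ⟧ˡ x →
                  ∀ J → ⟦ J ⟧ⁱ ⊆ ⟦ A ⟧ˡ → x ∈ ⟦ J ⟧ⁱ → x ≤ lower J
    left-≤lower A (_ , e) J J⊆A x∈J =
      ≮⇒≥ λ l<x → e (lower J) l<x (λ z l≤z z≤x → J⊆A (down J x∈J l≤z z≤x))

    left? : ∀ A x → Dec (LeftEndpoint ⟦ A ⟧ˡ x)
    left? A x = map′ to from
      ((x ∈ᴸ? A) ×-dec all? (λ J → (x ∈ⁱ? J) →-dec (x ≤? lower J)) A)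
      where
      from : LeftEndpoint ⟦ A ⟧ˡ x →
             x ∈ ⟦ A ⟧ˡ × All (λ J → x ∈ ⟦ J ⟧ⁱ → x ≤ lower J) A
      from e = proj₁ e , tabulateᴸ A (left-≤lower A e)

      to : x ∈ ⟦ A ⟧ˡ × All (λ J → x ∈ ⟦ J ⟧ⁱ → x ≤ lower J) A →
           LeftEndpoint ⟦ A ⟧ˡ x
      to (x∈A , ps) = x∈A , λ y y<x h →
        let m , y≤m , m<x , qs = leftGap A y<x
            z , m<z , z<x      = dense m<x
            z∈A                = h z (≤.trans y≤m (inj₁ m<z)) (inj₁ z<x)
        in lookupᴸ (All.zip (ps , qs)) z∈A λ J (p , q) z∈J →
             ≤⇒≯ (≤.trans (p (q z m<z z<x z∈J)) (lower-≤ J z∈J)) z<x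

    right-above : ∀ A {x} → RightEndpoint ⟦ A ⟧ˡ x →
                  ∀ J → ⟦ J ⟧ⁱ ⊆ ⟦ A ⟧ˡ → x ∈ ⟦ J ⟧ⁱ → Above J x
    right-above A (_ , e) J J⊆A x∈J = go J J⊆A x∈J
      where
      go : ∀ J → ⟦ J ⟧ⁱ ⊆ ⟦ A ⟧ˡ → _ ∈ ⟦ J ⟧ⁱ → Above J _
      go [ i , j ] J⊆A (i≤x , _) = here (≮⇒≥ λ x<j →
        e j x<j (λ z x≤z z≤j → J⊆A (≤.trans i≤x x≤z , z≤j)))
      go [ i ,+∞⟩  J⊆A i≤x = ⊥-elim (no-maximum _ λ y → ≮⇒≥ λ x<y →
        e y x<y (λ z x≤z _ → J⊆A (≤.trans i≤x x≤z)))
      go ⟨-∞, j ]  J⊆A _ = here (≮⇒≥ λ x<j →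
        e j x<j (λ z _ z≤j → J⊆A z≤j))

    right? : ∀ A x → Dec (RightEndpoint ⟦ A ⟧ˡ x)
    right? A x = map′ to from
      ((x ∈ᴸ? A) ×-dec all? (λ J → (x ∈ⁱ? J) →-dec any? (_≤? x) (uppers J)) A)
      where
      from : RightEndpoint ⟦ A ⟧ˡ x →
             x ∈ ⟦ A ⟧ˡ × All (λ J → x ∈ ⟦ J ⟧ⁱ → Above J x) A
      from e = proj₁ e , tabulateᴸ A (right-above A e)

      to : x ∈ ⟦ A ⟧ˡ × All (λ J → x ∈ ⟦ J ⟧ⁱ → Above J x) A →
           RightEndpoint ⟦ A ⟧ˡ x
      to (x∈A , ps) = x∈A , λ y x<y h →
        let m , m≤y , x<m , qs = rightGap A x<y
            z , x<z , z<m      = dense x<m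
            z∈A                = h z (inj₁ x<z) (≤.trans (inj₁ z<m) m≤y)
        in lookupᴸ (All.zip (ps , qs)) z∈A λ J (p , q) z∈J →
             ≤⇒≯ (above-≥ J (p (q z x<z z<m z∈J)) z z∈J) x<z

    Left-resp : ∀ {p} {P : Pred Carrier p} → P Respects _≈_ →
                LeftEndpoint P Respects _≈_
    Left-resp resp x≈y (x∈P , e) = resp x≈y x∈P , λ z z<y h →
      e z (<.<-respʳ-≈ (Eq.sym x≈y) z<y) (λ w z≤w w≤x → h w z≤w (≤.≤-respʳ-≈ x≈y w≤x))

    Right-resp : ∀ {p} {P : Pred Carrier p} → P Respects _≈_ →
                 RightEndpoint P Respects _≈_
    Right-resp resp x≈y (x∈P , e) = resp x≈y x∈P , λ z y<z h →
      e z (<.<-respˡ-≈ (Eq.sym x≈y) y<z) (λ w x≤w w≤z → h w (≤.≤-respˡ-≈ x≈y x≤w) w≤z)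

    meetFrom : Carrier → ClosedInterval → ClosedInterval
    meetFrom i [ k , l ] = [ i ⊔.⊔ k , l ]
    meetFrom i [ k ,+∞⟩  = [ i ⊔.⊔ k ,+∞⟩
    meetFrom i ⟨-∞, l ]  = [ i , l ]

    meetUpTo : Carrier → ClosedInterval → ClosedInterval
    meetUpTo j [ k , l ] = [ k , j ⊓.⊓ l ]
    meetUpTo j [ k ,+∞⟩  = [ k , j ]
    meetUpTo j ⟨-∞, l ]  = ⟨-∞, j ⊓.⊓ l ]

    meet : ClosedInterval → ClosedInterval → ClosedInterval
    meet [ i , j ] K = meetFrom i (meetUpTo j K)
    meet [ i ,+∞⟩  K = meetFrom i K
    meet ⟨-∞, j ]  K = meetUpTo j K

    ⊔-≤ : ∀ {i k x} → i ⊔.⊔ k ≤ x → i ≤ x × k ≤ x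
    ⊔-≤ {i} {k} h = ⊔.x⊔y≤z⇒x≤z i k h , ⊔.x⊔y≤z⇒y≤z i k h

    ≤-⊓ : ∀ {j l x} → x ≤ j ⊓.⊓ l → x ≤ j × x ≤ l
    ≤-⊓ {j} {l} h = ⊓.x≤y⊓z⇒x≤y j l h , ⊓.x≤y⊓z⇒x≤z j l h

    meetFrom-∈ : ∀ i K → ⟦ meetFrom i K ⟧ⁱ ≐ (i ≤_) ∩ ⟦ K ⟧ⁱ
    meetFrom-∈ i [ k , l ] =
      (λ (h , x≤l) → let i≤x , k≤x = ⊔-≤ h in i≤x , k≤x , x≤l) ,
      (λ (i≤x , k≤x , x≤l) → ⊔.⊔-lub i≤x k≤x , x≤l)
    meetFrom-∈ i [ k ,+∞⟩  = ⊔-≤ , λ (i≤x , k≤x) → ⊔.⊔-lub i≤x k≤x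
    meetFrom-∈ i ⟨-∞, l ]  = id , id

    meetUpTo-∈ : ∀ j K → ⟦ meetUpTo j K ⟧ⁱ ≐ (_≤ j) ∩ ⟦ K ⟧ⁱ
    meetUpTo-∈ j [ k , l ] =
      (λ (k≤x , h) → let x≤j , x≤l = ≤-⊓ h in x≤j , k≤x , x≤l) ,
      (λ (x≤j , k≤x , x≤l) → k≤x , ⊓.⊓-glb x≤j x≤l)
    meetUpTo-∈ j [ k ,+∞⟩  = Product.swap , Product.swap
    meetUpTo-∈ j ⟨-∞, l ]  = ≤-⊓ , λ (x≤j , x≤l) → ⊓.⊓-glb x≤j x≤l

    meet-∈ : ∀ J K → ⟦ meet J K ⟧ⁱ ≐ ⟦ J ⟧ⁱ ∩ ⟦ K ⟧ⁱ
    meet-∈ [ i , j ] K =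
      (λ h → let i≤x , h′  = proj₁ (meetFrom-∈ i (meetUpTo j K)) h
                 x≤j , x∈K = proj₁ (meetUpTo-∈ j K) h′
             in (i≤x , x≤j) , x∈K) ,
      (λ ((i≤x , x≤j) , x∈K) →
        proj₂ (meetFrom-∈ i (meetUpTo j K)) (i≤x , proj₂ (meetUpTo-∈ j K) (x≤j , x∈K)))
    meet-∈ [ i ,+∞⟩  K = meetFrom-∈ i K
    meet-∈ ⟨-∞, j ]  K = meetUpTo-∈ j K

  unionL : ∀ A B → ∃[ S ] ⟦ S ⟧ˡ ≐ ⟦ A ⟧ˡ ∪ ⟦ B ⟧ˡ
  unionL A B = A ++ B , Anyₚ.++⁻ A , Sum.[ Anyₚ.++⁺ˡ , Anyₚ.++⁺ʳ A ]

  interL : ∀ A B → ∃[ S ] ⟦ S ⟧ˡ ≐ ⟦ A ⟧ˡ ∩ ⟦ B ⟧ˡ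
  interL A B =
    cartesianProductWith meet A B ,
    (λ {x} → Anyₚ.cartesianProductWith⁻ meet (λ {J} {K} → proj₁ (meet-∈ J K)) A B) ,
    (λ {x} (x∈A , x∈B) →
      Anyₚ.cartesianProductWith⁺ meet (λ {J} {K} u v → proj₂ (meet-∈ J K) (u , v)) x∈A x∈B)

  emptyL : ∃[ S ] ⟦ S ⟧ˡ ≐ ∅
  emptyL = [] , (λ ()) , λ ()

  originL : ∃[ S ] ⟦ S ⟧ˡ ≐ Singleton 0#
  originL = [ 0# , 0# ] ∷ [] ,
    (λ { (here (u , v)) → ≤.antisym v u }) ,
    (λ e → here (inj₂ (Eq.sym e) , inj₂ e))

  points : ∀ (A : FinSet) → ∃[ S ] ⟦ S ⟧ˡ ≐ ⟦ A ⟧ʷ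
  points A = map (λ i → [ i , i ]) A ,
    (λ {x} h → Any.map (λ (u , v) → ≤.antisym v u) (Anyₚ.map⁻ h)) ,
    (λ {x} h → Anyₚ.map⁺ (Any.map (λ e → inj₂ (Eq.sym e) , inj₂ e) h))

  -- The values of min, max, l and r on L(I) are finite sets.  If A is
  -- empty or unbounded then it has no greatest element, whence
  -- max A = ∅.

  minL : ∀ A → ∃[ S ] ⟦ S ⟧ʷ ≐ Least ⟦ A ⟧ˡ
  minL A = collect (least? A) (Least-resp (respᴸ A)) (map lower A)
    λ (x∈A , lb) → lowers-∈ A x∈A
      (λ J J⊆A x∈J → lb _ (J⊆A (down J x∈J ≤.refl (lower-≤ J x∈J))))

  maxL : ∀ A → ∃[ S ] ⟦ S ⟧ʷ ≐ Greatest ⟦ A ⟧ˡ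
  maxL A = collect (greatest? A) (Greatest-resp (respᴸ A)) (concatMap uppers A)
    λ (x∈A , ub) → uppers-∈ A x∈A
      (λ J J⊆A x∈J → bounded⇒above J x∈J (λ z z∈J → ub z (J⊆A z∈J)))

  leftEndpoints : ∀ A → ∃[ S ] ⟦ S ⟧ʷ ≐ LeftEndpoint ⟦ A ⟧ˡ
  leftEndpoints A = collect (left? A) (Left-resp (respᴸ A)) (map lower A)
    λ e → lowers-∈ A (proj₁ e) (left-≤lower A e)

  rightEndpoints : ∀ A → ∃[ S ] ⟦ S ⟧ʷ ≐ RightEndpoint ⟦ A ⟧ˡ
  rightEndpoints A = collect (right? A) (Right-resp (respᴸ A)) (concatMap uppers A)
    λ e → uppers-∈ A (proj₁ e) (right-above A e)

  L : Structure signatureL c (c ⊔ ℓ₁ ⊔ ℓ₂)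
  L = record { setoid = setoidL ; op = op ; op-cong = op-cong }
    where
    open Setoid setoidL using () renaming (_≈_ to _≈ˡ_)
    open Setoid setoidW using () renaming (_≈_ to _≈ʷ_)

    asPoints : FinSet → IntervalUnion
    asPoints S = proj₁ (points S)

    op : ∀ f → Vector IntervalUnion (arity signatureL f) → IntervalUnion
    op union  A = proj₁ (unionL (A 0F) (A 1F))
    op inter  A = proj₁ (interL (A 0F) (A 1F))
    op empty  A = proj₁ emptyL
    op origin A = proj₁ originL
    op min    A = asPoints (proj₁ (minL (A 0F)))
    op max    A = asPoints (proj₁ (maxL (A 0F)))
    op left   A = asPoints (proj₁ (leftEndpoints (A 0F)))
    op right  A = asPoints (proj₁ (rightEndpoints (A 0F)))

    asPoints-cong : ∀ S T → S ≈ʷ T → asPoints S ≈ˡ asPoints T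
    asPoints-cong S T (f , g) = lift≐ (proj₂ (points S)) (proj₂ (points T)) f g

    op-cong : ∀ f {A B : Vector IntervalUnion (arity signatureL f)} →
              (∀ i → A i ≈ˡ B i) → op f A ≈ˡ op f B
    op-cong union {A} {B} e =
      lift≐ (proj₂ (unionL (A 0F) (A 1F))) (proj₂ (unionL (B 0F) (B 1F)))
        (∪-mono (e 0F) (e 1F)) (∪-mono (≐-sym (e 0F)) (≐-sym (e 1F)))
    op-cong inter {A} {B} e =
      lift≐ (proj₂ (interL (A 0F) (A 1F))) (proj₂ (interL (B 0F) (B 1F)))
        (∩-mono (e 0F) (e 1F)) (∩-mono (≐-sym (e 0F)) (≐-sym (e 1F)))
    op-cong empty  e = id , id
    op-cong origin e = id , id
    op-cong min {A} {B} e = asPoints-cong _ _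
      (lift≐ (proj₂ (minL (A 0F))) (proj₂ (minL (B 0F)))
        (Least-mono (e 0F)) (Least-mono (≐-sym (e 0F))))
    op-cong max {A} {B} e = asPoints-cong _ _
      (lift≐ (proj₂ (maxL (A 0F))) (proj₂ (maxL (B 0F)))
        (Greatest-mono (e 0F)) (Greatest-mono (≐-sym (e 0F))))
    op-cong left {A} {B} e = asPoints-cong _ _
      (lift≐ (proj₂ (leftEndpoints (A 0F))) (proj₂ (leftEndpoints (B 0F)))
        (Left-mono (e 0F)) (Left-mono (≐-sym (e 0F))))
    op-cong right {A} {B} e = asPoints-cong _ _
      (lift≐ (proj₂ (rightEndpoints (A 0F))) (proj₂ (rightEndpoints (B 0F)))
        (Right-mono (e 0F)) (Right-mono (≐-sym (e 0F))))

  endpoints : IntervalUnion → Vector FinSet 2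
  endpoints A =
    proj₁ (leftEndpoints A) Vector.∷ proj₁ (rightEndpoints A) Vector.∷ Vector.[]

{-# OPTIONS --safe #-}
-- A point z lies in A exactly when some left endpoint p ≤ z of A is not
-- separated from z by a right endpoint b with p ≤ b < z.  Membership in A is
-- thus first-order over I in l(A) and r(A), and so are all operations of L(I),
-- which are defined pointwise.  Quantification over points of I is available in
-- W(I) as quantification over singletons, ordered by min.  Conversely, the set
-- of points z as above is a finite union of closed intervals for any finite sets
-- in place of l(A) and r(A), so a pair is in the image of the co-ordinate map
-- precisely when it consists of the endpoints of the set that it determines.
module Submission where

open import Defs
open import Data.Empty using (⊥; ⊥-elim)
open import Data.Fin.Base using (Fin)
open import Data.Fin.Patterns using (0F; 1F; 2F)
open import Data.List.Base using (List; []; _∷_; filter; length; mapMaybe)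
import Data.List.Membership.Propositional as List
open import Data.List.Membership.Propositional.Properties using (∈-filter⁺)
import Data.List.Membership.Setoid as Membership
import Data.List.Membership.Setoid.Properties as Membershipₚ
open import Data.List.Properties using (filter-notAll)
open import Data.List.Relation.Unary.All as All using (All; []; _∷_)
open import Data.List.Relation.Unary.Any as Any using (Any; here; there; any?)
import Data.List.Relation.Unary.Any.Properties as Anyₚ
open import Data.Maybe.Base using (Maybe; just; nothing; maybe′)
import Data.Maybe.Relation.Unary.All as MAll
import Data.Maybe.Relation.Unary.Any as MAny
open import Data.Nat.Base using (suc) renaming (_<_ to _<ℕ_)
open import Data.Nat.Induction using (Acc; acc; <-wellFounded)
open import Data.Product.Base as Product using (∃; ∃-syntax; _×_; _,_; proj₁; proj₂; -,_)
open import Data.Product.Function.NonDependent.Propositional using (_×-⇔_)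
open import Data.Sum.Base as Sum using (_⊎_; inj₁; inj₂)
open import Data.Sum.Function.Propositional using (_⊎-⇔_)
open import Data.Vec.Functional as Vector using (Vector)
open import Function.Base using (_∘_; id)
open import Function.Bundles using (_⇔_; mk⇔; module Equivalence)
open import Function.Construct.Composition using (_⇔-∘_)
open import Function.Related.TypeIsomorphisms using (→-cong-⇔)
open import Level using (Level; lift; lower; _⊔_)
open import Relation.Binary.Bundles using (DecTotalOrder)
import Relation.Binary.Construct.Flip.EqAndOrd as Flip
open import Relation.Binary.Definitions using (_Respects_; tri<; tri≈; tri>)
open import Relation.Binary.PropositionalEquality.Core using (_≡_; refl)
open import Relation.Nullary using (¬_; Dec; yes; no; contradiction)
open import Relation.Nullary.Decidable using (¬?; _×-dec_; decidable-stable)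
open import Relation.Unary using (Pred; _⊆_; _≐_)
open import Relation.Unary.Properties using (≐-sym; ≐-trans; ≐-refl)

open Equivalence using (to; from)

-- Climbing to an endpoint of a finite union of convex pieces.

-- The dual statements about lower endpoints come from the flipped order, so
-- y < x is spelled ¬ x ≤ y, which flips definitionally.
module Upwards {c ℓ₁ ℓ₂} (O : DecTotalOrder c ℓ₁ ℓ₂) where
  open DecTotalOrder O renaming (refl to ≤-refl; trans to ≤-trans)

  ≰⇒≤ : ∀ {x y} → ¬ y ≤ x → x ≤ y
  ≰⇒≤ {x} {y} y≰x = Sum.[ id , (λ y≤x → contradiction y≤x y≰x) ]′ (total x y)

  -- Strict ascent through a finite list must stop. `T` keeps the elements of `S` strictly above the
  -- current point; moving up to y discards at least y itself, so the length of `T` is the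
  -- decreasing measure.
  ascend : ∀ {p q} {P : Pred Carrier p} {Q : Pred Carrier q} S →
           (∀ {x} → P x → Q x ⊎ ∃[ y ] (y List.∈ S × ¬ y ≤ x × P y)) →
           ∃ P → ∃ Q
  ascend {P = P} {Q} S step (x , Px) = go S (<-wellFounded _) (λ y∈S _ → y∈S) Px
    where
    go : ∀ T → Acc _<ℕ_ (length T) →
         ∀ {x} → (∀ {y} → y List.∈ S → ¬ y ≤ x → y List.∈ T) → P x → ∃ Q
    go T (acc rec) {x} S⊆T Px with step Px
    ... | inj₁ Qx = -, Qx
    ... | inj₂ (y , y∈S , y≰x , Py) =
      go (filter above? T)
        (rec (filter-notAll above? T (List.lose (S⊆T y∈S y≰x) (λ y≰y → y≰y ≤-refl))))
        (λ s∈S s≰y → ∈-filter⁺ above?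
          (S⊆T s∈S (λ s≤x → s≰y (≤-trans s≤x (≰⇒≤ y≰x)))) s≰y)
        Py
      where
      above? = λ s → ¬? (s ≤? y)

  UpperEndpoint : ∀ {p} → Pred Carrier p → Pred Carrier _
  UpperEndpoint P x =
    P x × (∀ y → ¬ y ≤ x → ¬ (∀ z → x ≤ z → z ≤ y → P z))

  -- A piece with bound nothing is unbounded on that side.
  module _ {b} {B : Set b} (lo hi : B → Maybe Carrier) where

    Within : B → Pred Carrier _
    Within J x = MAll.All (_≤ x) (lo J) × MAll.All (x ≤_) (hi J)

    -- The witness m is the least among y and those lower bounds of pieces of `A` that exceed x. A
    -- lower bound that is at most some z below m is then itself below m, hence at most x.
    gap : ∀ A {x y} → ¬ y ≤ x → ∃[ m ] (m ≤ y × ¬ m ≤ x ×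
          All (λ J → ∀ {z} → ¬ m ≤ z → MAll.All (_≤ z) (lo J) → MAll.All (_≤ x) (lo J)) A)
    gap []      y≰x = _ , ≤-refl , y≰x , []
    gap (J ∷ A) y≰x =
      let m , m≤y , m≰x , p  = one (lo J) y≰x
          n , n≤m , n≰x , ps = gap A m≰x
      in n , ≤-trans n≤m m≤y , n≰x , (λ n≰z → p (n≰z ∘ ≤-trans n≤m)) ∷ ps
      where
      one : ∀ l {x y} → ¬ y ≤ x → ∃[ m ] (m ≤ y × ¬ m ≤ x ×
            (∀ {z} → ¬ m ≤ z → MAll.All (_≤ z) l → MAll.All (_≤ x) l))
      one nothing  y≰x = _ , ≤-refl , y≰x , λ _ _ → MAll.nothing
      one (just s) {x} {y} y≰x with s ≤? x | total s y
      ... | yes s≤x | _        = y , ≤-refl , y≰x , λ _ _ → MAll.just s≤x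
      ... | no  s≰x | inj₁ s≤y = s , s≤y , s≰x ,
        λ s≰z s≤z → contradiction (MAll.drop-just s≤z) s≰z
      ... | no  s≰x | inj₂ y≤s = y , ≤-refl , y≰x ,
        λ y≰z s≤z → contradiction (≤-trans y≤s (MAll.drop-just s≤z)) y≰z

    module _ (dense : ∀ {x y} → ¬ y ≤ x → ∃[ z ] (¬ z ≤ x × ¬ y ≤ z))
             (A : List B) where

      Union : Pred Carrier _
      Union x = Any (λ J → Within J x) A

      private
        Continues : Carrier → B → Set _
        Continues x J = Within J x × ¬ MAny.Any (_≤ x) (hi J)

        continues? : ∀ x J → Dec (Continues x J)
        continues? x J =
          (MAll.dec (_≤? x) (lo J) ×-dec MAll.dec (x ≤?_) (hi J)) ×-dec
          ¬? (MAny.dec (_≤? x) (hi J))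

        -- Otherwise the union would contain a segment from x to some y above it. By density this
        -- segment has a point z between x and the m of `gap`. The piece containing z starts at or
        -- below x by the choice of m, and it goes beyond x, so it continues at x.
        upperEndpoint : ∀ {x} → Union x → ¬ Any (Continues x) A → UpperEndpoint Union x
        upperEndpoint {x} x∈A ¬c = x∈A , λ y y≰x h →
          let m , m≤y , m≰x , ps = gap A y≰x
              z , z≰x , m≰z      = dense m≰x
              J , J∈A , z∈J      = List.find (h z (≰⇒≤ z≰x) (≤-trans (≰⇒≤ m≰z) m≤y))
          in ¬c (List.lose J∈A
               ( (All.lookup ps J∈A m≰z (proj₁ z∈J)
                 , MAll.map (≤-trans (≰⇒≤ z≰x)) (proj₂ z∈J))
               , stops z≰x (proj₂ z∈J)))
          where
          stops : ∀ {z u} → ¬ z ≤ x → MAll.All (z ≤_) u → ¬ MAny.Any (_≤ x) u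
          stops z≰x (MAll.just z≤u) (MAny.just u≤x) = z≰x (≤-trans z≤u u≤x)

        next : ∀ {x} u → MAll.All (x ≤_) u → ¬ MAny.Any (_≤ x) u →
               (∀ w → MAll.All (w ≤_) u) ⊎
               ∃[ y ] (MAny.Any (y ≡_) u × ¬ y ≤ x × (∀ w → w ≤ y → MAll.All (w ≤_) u))
        next nothing  _ _  = inj₁ λ _ → MAll.nothing
        next (just y) _ ¬s = inj₂ (y , MAny.just refl , ¬s ∘ MAny.just , λ _ → MAll.just)

      FilledUpTo : Carrier → Carrier → Set _
      FilledUpTo z e = z ≤ e × (∀ w → z ≤ w → w ≤ e → Union w)

      -- Climb from z along upper bounds of the pieces, keeping the segment from z to the current
      -- point inside the union. The climb ends where no piece continues, which is an endpoint, or
      -- at a piece with no upper bound.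
      reach : ∀ {z} → Union z →
              ∃[ e ] (UpperEndpoint Union e × FilledUpTo z e) ⊎ (∀ w → z ≤ w → Union w)
      reach {z} z∈A =
        Sum.[ inj₁ ∘ (_ ,_) , inj₂ ]′
          (proj₂ (ascend (mapMaybe hi A) step (z , ≤-refl , start)))
        where
        start : ∀ w → z ≤ w → w ≤ z → Union w
        start w z≤w w≤z = Any.map
          (λ (l , u) → MAll.map (λ l≤z → ≤-trans l≤z z≤w) l , MAll.map (≤-trans w≤z) u) z∈A

        step : ∀ {x} → FilledUpTo z x →
               ((UpperEndpoint Union x × FilledUpTo z x) ⊎ (∀ w → z ≤ w → Union w)) ⊎
               ∃[ y ] (y List.∈ mapMaybe hi A × ¬ y ≤ x × FilledUpTo z y)
        step {x} (z≤x , f) with any? (continues? x) A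
        ... | no ¬c = inj₁ (inj₁ (upperEndpoint (f x z≤x ≤-refl) ¬c , z≤x , f))
        ... | yes c =
          -- `J` contains x and goes beyond it, so it fills everything from x up to its upper bound,
          -- or the whole ray if it has none.
          let J , J∈A , (l , u) , ¬s = List.find c
              extend = λ w x≤w w∈u → List.lose J∈A (MAll.map (λ l≤x → ≤-trans l≤x x≤w) l , w∈u)
          in Sum.map
            (λ g → inj₂ λ w z≤w →
              Sum.[ f w z≤w , (λ x≤w → extend w x≤w (g w)) ]′ (total w x))
            (λ (y , y∈u , y≰x , g) →
              y , Anyₚ.mapMaybe⁺ hi A (Anyₚ.map⁺ (List.lose J∈A y∈u)) , y≰x ,
              ≤-trans z≤x (≰⇒≤ y≰x) ,
              λ w z≤w w≤y →
                Sum.[ f w z≤w , (λ x≤w → extend w x≤w (g w w≤y)) ]′ (total w x))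
            (next (hi J) u ¬s)

-- Defining formulas in terms of points.

-- First-order formulas over I, with free variables in V for finite sets, which
-- are not quantified, and in P for points.

infix  8 _∈′_ _≤′_ _<′_
infixr 7 _∧′_
infixr 6 _∨′_
infixr 5 _⇒′_
infix  4 _⇔′_

data PointFormula (V P : Set) : Set where
  _∈′_           : P → V → PointFormula V P
  _≤′_ _<′_      : P → P → PointFormula V P
  ¬′_            : PointFormula V P → PointFormula V P
  _∧′_ _∨′_ _⇒′_ : PointFormula V P → PointFormula V P → PointFormula V P
  ∀′ ∃′          : PointFormula V (Maybe P) → PointFormula V P

_⇔′_ : ∀ {V P} → PointFormula V P → PointFormula V P → PointFormula V P
φ ⇔′ ψ = (φ ⇒′ ψ) ∧′ (ψ ⇒′ φ)

between′ : ∀ {V P} → V → V → P → PointFormula V P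
between′ s t x = ∃′ (nothing ∈′ s ∧′ nothing ≤′ just x ∧′
  ∀′ (nothing ∈′ t ⇒′ just nothing ≤′ nothing ⇒′ just (just x) ≤′ nothing))

-- `φ` is polymorphic in the type of point variables, so that it can be stated again under
-- quantifiers without a substitution operation on formulas.
least′ greatest′ left′ right′ :
  ∀ {V P} → (∀ {Q} → Q → PointFormula V Q) → P → PointFormula V P
least′    φ x = φ x ∧′ ∀′ (φ nothing ⇒′ just x ≤′ nothing)
greatest′ φ x = φ x ∧′ ∀′ (φ nothing ⇒′ nothing ≤′ just x)
left′  φ x = φ x ∧′ ∀′ (nothing <′ just x ⇒′
  ¬′ (∀′ (just nothing ≤′ nothing ⇒′ nothing ≤′ just (just x) ⇒′ φ nothing)))
right′ φ x = φ x ∧′ ∀′ (just x <′ nothing ⇒′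
  ¬′ (∀′ (just (just x) ≤′ nothing ⇒′ nothing ≤′ just nothing ⇒′ φ nothing)))

member′ : ∀ {n P} → Fin n → P → PointFormula (Fin n × Fin 2) P
member′ j = between′ (j , 0F) (j , 1F)

-- The points of f(x₁,…,xₖ); the index 0F is that of the value x₀.
value : ∀ f {P} → P → PointFormula (Fin (suc (arity signatureL f)) × Fin 2) P
value union  x = member′ 1F x ∨′ member′ 2F x
value inter  x = member′ 1F x ∧′ member′ 2F x
value empty  x = x <′ x
value origin x = ∀′ (just x ≤′ nothing)
value min    x = least′ (member′ 1F) x
value max    x = greatest′ (member′ 1F) x
value left   x = left′ (member′ 1F) x
value right  x = right′ (member′ 1F) x

domain′ : PointFormula (Fin 2) ⊥
domain′ = ∀′ (nothing ∈′ 0F ⇔′ left′ (between′ 0F 1F) nothing) ∧′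
          ∀′ (nothing ∈′ 1F ⇔′ right′ (between′ 0F 1F) nothing)

graph′ : ∀ f → PointFormula (Fin (suc (arity signatureL f)) × Fin 2) ⊥
graph′ f = ∀′ (member′ 0F nothing ⇔′ value f nothing)

equality′ : PointFormula (Fin 2 × Fin 2) ⊥
equality′ = ∀′ (member′ 0F nothing ⇔′ member′ 1F nothing)

-- Translation into formulas of W(I).

private
  variable
    V P X : Set

  _∪ᵗ_ : Term signatureW X → Term signatureW X → Term signatureW X
  s ∪ᵗ t = app union (s Vector.∷ t Vector.∷ Vector.[])

  minᵗ : Term signatureW X → Term signatureW X
  minᵗ t = app min (t Vector.∷ Vector.[])

  ∅ᵗ : Term signatureW X
  ∅ᵗ = app empty Vector.[]

-- Singletons are the nonempty fixed points of `min`; the empty set is fixed as well and has to be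
-- excluded.
isPoint : X → Formula signatureW X
isPoint x = (var x ≋ ∅ᵗ ⇒ falsum) ∧ minᵗ (var x) ≋ var x

-- Equality is the only relation available in W(I), so membership becomes absorption under union,
-- and the order is read off from `min` of a two-point set. Strict order is the negation of the
-- reverse weak order, by linearity. The maps `s` and `p` put sets and points into one sort of
-- variables, points being singletons.
translate : PointFormula V P → (V → X) → (P → X) → Formula signatureW X
translate (x ∈′ v) s p = (var (p x) ∪ᵗ var (s v)) ≋ var (s v)
translate (x ≤′ y) s p = minᵗ (var (p x) ∪ᵗ var (p y)) ≋ var (p x)
translate (x <′ y) s p = minᵗ (var (p y) ∪ᵗ var (p x)) ≋ var (p y) ⇒ falsum
translate (¬′ φ)   s p = translate φ s p ⇒ falsum
translate (φ ∧′ ψ) s p = translate φ s p ∧ translate ψ s p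
translate (φ ∨′ ψ) s p = translate φ s p ∨ translate ψ s p
translate (φ ⇒′ ψ) s p = translate φ s p ⇒ translate ψ s p
translate (∀′ φ)   s p =
  forAll (isPoint nothing ⇒ translate φ (just ∘ s) (maybe′ (just ∘ p) nothing))
translate (∃′ φ)   s p =
  exists (isPoint nothing ∧ translate φ (just ∘ s) (maybe′ (just ∘ p) nothing))

sentence : PointFormula V ⊥ → Formula signatureW V
sentence φ = translate φ id ⊥-elim

module _ {c ℓ₁ ℓ₂} (I : LeftEndpointDLO c ℓ₁ ℓ₂) where
  open LeftEndpointDLO I
    using (Carrier; _≈_; _<_; _≤_; _≤?_; decTotalOrder; 0#; 0#-minimum; dense; module Eq)
  private module < = LeftEndpointDLO I
  open DecTotalOrder decTotalOrder using (antisym; ≤-respʳ-≈; ≤-respˡ-≈; reflexive)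
    renaming (trans to ≤-trans)
  open Membership Eq.setoid using (_∈_)
  open Structure (W I) using () renaming (_≈_ to _≈ʷ_)
  open Structure (L I) using () renaming (_≈_ to _≈ˡ_; op to opL)

  private
    <⇒≱ : ∀ {x y} → x < y → ¬ y ≤ x
    <⇒≱ x<y (inj₁ y<x) = <.asym x<y y<x
    <⇒≱ x<y (inj₂ y≈x) = <.irrefl (Eq.sym y≈x) x<y

    ≰⇒> : ∀ {x y} → ¬ y ≤ x → x < y
    ≰⇒> {x} {y} y≰x with <.compare x y
    ... | tri< x<y _ _ = x<y
    ... | tri≈ _ x≈y _ = contradiction (inj₂ (Eq.sym x≈y)) y≰x
    ... | tri> _ _ y<x = contradiction (inj₁ y<x) y≰x

  -- Points as singletons, and correctness of the translation.

  point : Carrier → FinSet I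
  point x = x ∷ []

  -- With this level, Holds unfolds to the predicates of Defs without any Lift.
  level : PointFormula V P → Level
  level (_ ∈′ _) = c ⊔ ℓ₁
  level (_ ≤′ _) = ℓ₁ ⊔ ℓ₂
  level (_ <′ _) = ℓ₂
  level (¬′ φ)   = level φ
  level (φ ∧′ ψ) = level φ ⊔ level ψ
  level (φ ∨′ ψ) = level φ ⊔ level ψ
  level (φ ⇒′ ψ) = level φ ⊔ level ψ
  level (∀′ φ)   = c ⊔ level φ
  level (∃′ φ)   = c ⊔ level φ

  Holds : (φ : PointFormula V P) → (V → FinSet I) → (P → Carrier) → Set (level φ)
  Holds (x ∈′ v) ρ σ = σ x ∈ ρ v
  Holds (x ≤′ y) ρ σ = σ x ≤ σ y
  Holds (x <′ y) ρ σ = σ x < σ y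
  Holds (¬′ φ)   ρ σ = ¬ Holds φ ρ σ
  Holds (φ ∧′ ψ) ρ σ = Holds φ ρ σ × Holds ψ ρ σ
  Holds (φ ∨′ ψ) ρ σ = Holds φ ρ σ ⊎ Holds ψ ρ σ
  Holds (φ ⇒′ ψ) ρ σ = Holds φ ρ σ → Holds ψ ρ σ
  Holds (∀′ φ)   ρ σ = ∀ x → Holds φ ρ (maybe′ σ x)
  Holds (∃′ φ)   ρ σ = ∃[ x ] Holds φ ρ (maybe′ σ x)

  ∈-point : ∀ {A x y} → A ≈ʷ point x → y ∈ A → y ≈ x
  ∈-point A≈x y∈A with proj₁ A≈x y∈A
  ... | here e = e

  ∈-point⁻ : ∀ {A x} → A ≈ʷ point x → x ∈ A
  ∈-point⁻ A≈x = proj₂ A≈x (here Eq.refl)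

  ∈-resp : ∀ A → (_∈ A) Respects _≈_
  ∈-resp A = Membershipₚ.∈-resp-≈ Eq.setoid

  -- If a nonempty list equals its own `min` as a set, each of its elements is least, so by
  -- antisymmetry all of them agree with the head.
  isPoint-⊨ : (τ : X → FinSet I) (x : X) →
              _⊨_ (W I) τ (isPoint x) ⇔ (∃[ i ] τ x ≈ʷ point i)
  isPoint-⊨ τ x = mk⇔ to′ from′
    where
    to′ : _⊨_ (W I) τ (isPoint x) → ∃[ i ] τ x ≈ʷ point i
    to′ (ne , lift m) with τ x
    ... | []    = contradiction (lift ≐-refl) (lower ∘ ne)
    ... | i ∷ A = i ,
      (λ z∈ → here (antisym
        (least z∈ i (here Eq.refl)) (least (here Eq.refl) _ z∈))) ,
      (λ { (here e) → here e })
      where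
      least : ∀ {z} → z ∈ i ∷ A → ∀ y → y ∈ i ∷ A → z ≤ y
      least z∈ = proj₂ (proj₁ (proj₂ (minW I (i ∷ A))) (proj₂ m z∈))

    from′ : ∃[ i ] τ x ≈ʷ point i → _⊨_ (W I) τ (isPoint x)
    from′ (i , e) =
      (λ (lift e′) → contradiction (proj₁ e′ (proj₂ e (here Eq.refl))) λ ()) ,
      lift ((λ z∈ → proj₁ (proj₁ (proj₂ (minW I (τ x))) z∈)) ,
            λ z∈ → proj₂ (proj₂ (minW I (τ x)))
              (z∈ , λ y y∈ → reflexive (Eq.trans (∈-point e z∈) (Eq.sym (∈-point e y∈)))))

  ∪-absorbs : ∀ {A i} S → A ≈ʷ point i → proj₁ (unionW I A S) ≈ʷ S ⇔ i ∈ S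
  ∪-absorbs {A} {i} S A≈i = mk⇔
    (λ e → proj₁ e (proj₂ u (inj₁ (∈-point⁻ A≈i))))
    (λ i∈S →
      (λ {z} z∈ → Sum.[ (λ z∈A → ∈-resp S (Eq.sym (∈-point A≈i z∈A)) i∈S) , id ]′
        (proj₁ u z∈)) ,
      (λ {z} z∈S → proj₂ u (inj₂ z∈S)))
    where
    u = proj₂ (unionW I A S)

  min-∪ : ∀ {A B i j} → A ≈ʷ point i → B ≈ʷ point j →
          proj₁ (minW I (proj₁ (unionW I A B))) ≈ʷ A ⇔ i ≤ j
  min-∪ {A} {B} {i} {j} A≈i B≈j = mk⇔
    (λ e → proj₂ (proj₁ m (proj₂ e (∈-point⁻ A≈i))) j (proj₂ u (inj₂ (∈-point⁻ B≈j))))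
    (λ i≤j →
      (λ {z} z∈ → let z∈A∪B , z-least = proj₁ m z∈ in
         proj₂ A≈i (here (antisym
           (z-least i (proj₂ u (inj₁ (∈-point⁻ A≈i)))) (i-least i≤j z∈A∪B)))) ,
      (λ {z} z∈A → proj₂ m (proj₂ u (inj₁ z∈A) , λ w w∈ →
         ≤-respˡ-≈ (Eq.sym (∈-point A≈i z∈A)) (i-least i≤j w∈))))
    where
    u = proj₂ (unionW I A B)
    m = proj₂ (minW I (proj₁ (unionW I A B)))
    i-least : i ≤ j → ∀ {z} → z ∈ proj₁ (unionW I A B) → i ≤ z
    i-least i≤j z∈ = Sum.[
      (λ z∈A → reflexive (Eq.sym (∈-point A≈i z∈A))) ,
      (λ z∈B → ≤-respʳ-≈ (Eq.sym (∈-point B≈j z∈B)) i≤j) ]′ (proj₁ u z∈)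

  bind-point : ∀ {p : P → X} {τ σ A i} →
               (∀ x → τ (p x) ≈ʷ point (σ x)) → A ≈ʷ point i → ∀ x →
               maybe′ τ A (maybe′ (just ∘ p) nothing x) ≈ʷ point (maybe′ σ i x)
  bind-point pts e (just x) = pts x
  bind-point pts e nothing  = e

  -- The hypothesis asks for singletons only up to the equality of `W I`, because the quantifiers of
  -- W(I) range over all lists and a list satisfying `isPoint` may repeat its element. This is what
  -- lets the induction pass under a quantifier.
  translate-⊨ : (φ : PointFormula V P) {s : V → X} {p : P → X}
                {τ : X → FinSet I} {σ : P → Carrier} →
                (∀ x → τ (p x) ≈ʷ point (σ x)) →
                _⊨_ (W I) τ (translate φ s p) ⇔ Holds φ (τ ∘ s) σ
  translate-⊨ (x ∈′ v) {s} {τ = τ} pts =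
    let eq = ∪-absorbs (τ (s v)) (pts x) in mk⇔ (to eq ∘ lower) (lift ∘ from eq)
  translate-⊨ (x ≤′ y) pts =
    let eq = min-∪ (pts x) (pts y) in mk⇔ (to eq ∘ lower) (lift ∘ from eq)
  translate-⊨ (x <′ y) pts =
    let eq = min-∪ (pts y) (pts x) in mk⇔
      (λ h → ≰⇒> (lower ∘ h ∘ lift ∘ from eq))
      (λ x<y (lift e) → contradiction (to eq e) (<⇒≱ x<y))
  translate-⊨ (¬′ φ)   pts = →-cong-⇔ (translate-⊨ φ pts) (mk⇔ lower lift)
  translate-⊨ (φ ∧′ ψ) pts = translate-⊨ φ pts ×-⇔ translate-⊨ ψ pts
  translate-⊨ (φ ∨′ ψ) pts = translate-⊨ φ pts ⊎-⇔ translate-⊨ ψ pts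
  translate-⊨ (φ ⇒′ ψ) pts = →-cong-⇔ (translate-⊨ φ pts) (translate-⊨ ψ pts)
  translate-⊨ (∀′ φ) {τ = τ} {σ} pts = mk⇔
    (λ h i → to (translate-⊨ φ (bind-point pts ≐-refl))
      (h (point i) (from (isPoint-⊨ (maybe′ τ (point i)) nothing) (i , ≐-refl))))
    (λ h A pt → let i , e = to (isPoint-⊨ (maybe′ τ A) nothing) pt in
      from (translate-⊨ φ (bind-point pts e)) (h i))
  translate-⊨ (∃′ φ) {τ = τ} {σ} pts = mk⇔
    (λ (A , pt , h) → let i , e = to (isPoint-⊨ (maybe′ τ A) nothing) pt in
      i , to (translate-⊨ φ (bind-point pts e)) h)
    (λ (i , h) → point i ,
      from (isPoint-⊨ (maybe′ τ (point i)) nothing) (i , ≐-refl) ,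
      from (translate-⊨ φ (bind-point pts ≐-refl)) h)

  -- Endpoints of the components of a finite union of closed intervals.

  private
    module Up   = Upwards decTotalOrder
    module Down = Upwards (Flip.decTotalOrder decTotalOrder)

    lo hi : ClosedInterval I → Maybe Carrier
    lo [ i , _ ] = just i
    lo [ i ,+∞⟩  = just i
    lo ⟨-∞, _ ]  = nothing
    hi [ _ , j ] = just j
    hi [ _ ,+∞⟩  = nothing
    hi ⟨-∞, j ]  = just j

    within : ∀ J → ⟦_⟧ⁱ I J ≐ Up.Within lo hi J
    within [ i , j ] = Product.map MAll.just MAll.just ,
                       Product.map MAll.drop-just MAll.drop-just
    within [ i ,+∞⟩  = (λ l → MAll.just l , MAll.nothing) , MAll.drop-just ∘ proj₁
    within ⟨-∞, j ]  = (λ u → MAll.nothing , MAll.just u) , MAll.drop-just ∘ proj₂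

    dense↑ : ∀ {x y} → ¬ y ≤ x → ∃[ z ] (¬ z ≤ x × ¬ y ≤ z)
    dense↑ y≰x = let z , x<z , z<y = dense (≰⇒> y≰x) in z , <⇒≱ x<z , <⇒≱ z<y

    dense↓ : ∀ {x y} → ¬ x ≤ y → ∃[ z ] (¬ x ≤ z × ¬ z ≤ y)
    dense↓ x≰y = let z , z≰y , x≰z = dense↑ x≰y in z , x≰z , z≰y

    union↑ : ∀ A → ⟦_⟧ˡ I A ≐ Up.Union lo hi dense↑ A
    union↑ A = Any.map (λ {J} → proj₁ (within J)) , Any.map (λ {J} → proj₂ (within J))

    union↓ : ∀ A → ⟦_⟧ˡ I A ≐ Down.Union hi lo dense↓ A
    union↓ A = Any.map (λ {J} → Product.swap ∘ proj₁ (within J)) ,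
               Any.map (λ {J} → proj₂ (within J) ∘ Product.swap)

  reach-right : ∀ A {z} → ⟦_⟧ˡ I A z →
    ∃[ e ] (RightEndpoint I (⟦_⟧ˡ I A) e × z ≤ e × (∀ w → z ≤ w → w ≤ e → ⟦_⟧ˡ I A w)) ⊎
    (∀ w → z ≤ w → ⟦_⟧ˡ I A w)
  reach-right A z∈A = Sum.map
    (λ (e , (e∈U , end) , z≤e , fill) →
      e , (proj₂ (union↑ A) e∈U ,
           λ y e<y h → end y (<⇒≱ e<y) λ w u v → proj₁ (union↑ A) (h w u v)) ,
      z≤e , λ w u v → proj₂ (union↑ A) (fill w u v))
    (λ fill w u → proj₂ (union↑ A) (fill w u))
    (Up.reach lo hi dense↑ A (proj₁ (union↑ A) z∈A))

  -- There is no unbounded alternative as in `reach-right`: if everything below z lies in `A`, then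
  -- `0#` is a left endpoint, since nothing lies below it.
  reach-left : ∀ A {z} → ⟦_⟧ˡ I A z →
    ∃[ e ] (LeftEndpoint I (⟦_⟧ˡ I A) e × e ≤ z × (∀ w → e ≤ w → w ≤ z → ⟦_⟧ˡ I A w))
  reach-left A {z} z∈A with Down.reach hi lo dense↓ A (proj₁ (union↓ A) z∈A)
  ... | inj₁ (e , (e∈U , end) , e≤z , fill) =
    e , (proj₂ (union↓ A) e∈U ,
         λ y y<e h → end y (<⇒≱ y<e) λ w u v → proj₁ (union↓ A) (h w v u)) ,
    e≤z , λ w u v → proj₂ (union↓ A) (fill w v u)
  ... | inj₂ fill =
    0# , (proj₂ (union↓ A) (fill 0# (0#-minimum z)) ,
          λ y y<0 _ → <⇒≱ y<0 (0#-minimum y)) ,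
    0#-minimum z , λ w _ w≤z → proj₂ (union↓ A) (fill w w≤z)

  -- Recovering a set from its endpoints.

  -- `Holds` of `between′` unfolds to this predicate, so facts about it apply to the formulas
  -- directly.
  Between : FinSet I → FinSet I → Pred Carrier _
  Between S T z = ∃[ p ] (p ∈ S × p ≤ z × (∀ b → b ∈ T → p ≤ b → z ≤ b))

  Between-mono : ∀ {S S′ T T′} → S ≈ʷ S′ → T ≈ʷ T′ → Between S T ⊆ Between S′ T′
  Between-mono S≈S′ T≈T′ (p , p∈S , p≤z , h) =
    p , proj₁ S≈S′ p∈S , p≤z , λ b b∈T′ → h b (proj₂ T≈T′ b∈T′)

  Between-cong : ∀ {S S′ T T′} → S ≈ʷ S′ → T ≈ʷ T′ → Between S T ≐ Between S′ T′
  Between-cong {S} {S′} {T} {T′} e f =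
    Between-mono {S} {S′} {T} {T′} e f , Between-mono {S′} {S} {T′} {T} (≐-sym e) (≐-sym f)

  l r : IntervalUnion I → FinSet I
  l A = endpoints I A 0F
  r A = endpoints I A 1F

  l-∈ : ∀ A → ⟦_⟧ʷ I (l A) ≐ LeftEndpoint I (⟦_⟧ˡ I A)
  l-∈ A = proj₂ (leftEndpoints I A)

  r-∈ : ∀ A → ⟦_⟧ʷ I (r A) ≐ RightEndpoint I (⟦_⟧ˡ I A)
  r-∈ A = proj₂ (rightEndpoints I A)

  -- For z in `A`, let p be the left endpoint reached from z. A right endpoint b with p ≤ b < z is
  -- impossible, as the segment from b to z lies in `A`. Conversely, `A` is filled from p either up
  -- to a right endpoint e, and then z ≤ e because e does not separate p from z, or without bound.
  ∈-Between : ∀ A → ⟦_⟧ˡ I A ≐ Between (l A) (r A)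
  ∈-Between A = to′ , from′
    where
    to′ : ⟦_⟧ˡ I A ⊆ Between (l A) (r A)
    to′ {z} z∈A =
      let p , end , p≤z , fill = reach-left A z∈A in
      p , proj₂ (l-∈ A) end , p≤z , λ b b∈r p≤b → decidable-stable (z ≤? b) λ z≰b →
        proj₂ (proj₁ (r-∈ A) b∈r) z (≰⇒> z≰b) (λ w b≤w w≤z → fill w (≤-trans p≤b b≤w) w≤z)

    from′ : Between (l A) (r A) ⊆ ⟦_⟧ˡ I A
    from′ {z} (p , p∈l , p≤z , h) with reach-right A (proj₁ (proj₁ (l-∈ A) p∈l))
    ... | inj₁ (e , end , p≤e , fill) = fill z p≤z (h e (proj₂ (r-∈ A) end) p≤e)
    ... | inj₂ fill                   = fill z p≤z

  -- The ray from p is intersected with the ray below t for each t in `T` with p ≤ t; the remaining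
  -- t impose no condition.
  segment : ∀ p T → ∃[ S ] ⟦_⟧ˡ I S ≐ λ z → p ≤ z × (∀ b → b ∈ T → p ≤ b → z ≤ b)
  segment p [] = [ p ,+∞⟩ ∷ [] , (λ { (here p≤z) → p≤z , λ _ () }) , here ∘ proj₁
  segment p (t ∷ T) with segment p T | p ≤? t
  ... | S , f , g | yes p≤t =
    let S′ , f′ , g′ = interL I (⟨-∞, t ] ∷ []) S in
    S′ ,
    (λ z∈ → cons (f′ z∈)) ,
    λ (p≤z , h) → g′ (here (h t (here Eq.refl) p≤t) , g (p≤z , λ b → h b ∘ there))
    where
    cons : ∀ {z} → ⟦_⟧ˡ I (⟨-∞, t ] ∷ []) z × ⟦_⟧ˡ I S z →
           p ≤ z × (∀ b → b ∈ t ∷ T → p ≤ b → z ≤ b)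
    cons (here z≤t , z∈S) = proj₁ (f z∈S) ,
      λ { b (here b≈t) _ → ≤-respʳ-≈ (Eq.sym b≈t) z≤t
        ; b (there b∈T) → proj₂ (f z∈S) b b∈T }
  ... | S , f , g | no p≰t =
    S ,
    (λ z∈S → proj₁ (f z∈S) ,
      λ { b (here b≈t) p≤b → contradiction (≤-respʳ-≈ b≈t p≤b) p≰t
        ; b (there b∈T) → proj₂ (f z∈S) b b∈T }) ,
    λ (p≤z , h) → g (p≤z , λ b → h b ∘ there)

  -- A finite union of segments, one for each p in `S`. Since `S` and `T` are arbitrary, it gives
  -- every pair a candidate preimage under the co-ordinate map.
  Between-union : ∀ S T → ∃[ A ] ⟦_⟧ˡ I A ≐ Between S T
  Between-union []      T = [] , (λ ()) , λ { (_ , () , _) }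
  Between-union (p ∷ S) T =
    let A , f , g   = segment p T
        B , f′ , g′ = Between-union S T
        C , f″ , g″ = unionL I A B in
    C ,
    Sum.[ (λ z∈A → p , here Eq.refl , f z∈A)
        , (λ z∈B → let q , q∈S , h = f′ z∈B in q , there q∈S , h) ]′ ∘ f″ ,
    λ { (q , here q≈p , q≤z , h) → g″ (inj₁ (g
          ( ≤-respˡ-≈ q≈p q≤z
          , λ b b∈T p≤b → h b b∈T (≤-respˡ-≈ (Eq.sym q≈p) p≤b))))
      ; (q , there q∈S , h) → g″ (inj₂ (g′ (q , q∈S , h))) }

  -- Correctness of the defining formulas.

  module _ {p q} {P : Pred Carrier p} {Q : Pred Carrier q} where

    Least-mono : P ≐ Q → Least I P ⊆ Least I Q
    Least-mono (f , g) (x∈P , lb) = f x∈P , λ y → lb y ∘ g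

    Greatest-mono : P ≐ Q → Greatest I P ⊆ Greatest I Q
    Greatest-mono (f , g) (x∈P , ub) = f x∈P , λ y → ub y ∘ g

    LeftEndpoint-mono : P ≐ Q → LeftEndpoint I P ⊆ LeftEndpoint I Q
    LeftEndpoint-mono (f , g) (x∈P , e) =
      f x∈P , λ y y<x h → e y y<x λ z u v → g (h z u v)

    RightEndpoint-mono : P ≐ Q → RightEndpoint I P ⊆ RightEndpoint I Q
    RightEndpoint-mono (f , g) (x∈P , e) =
      f x∈P , λ y x<y h → e y x<y λ z u v → g (h z u v)

  module _ {p q} {P : Pred Carrier p} {Q : Pred Carrier q} (P≐Q : P ≐ Q) where

    Least-cong : Least I P ≐ Least I Q
    Least-cong = Least-mono P≐Q , Least-mono (≐-sym P≐Q)

    Greatest-cong : Greatest I P ≐ Greatest I Q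
    Greatest-cong = Greatest-mono P≐Q , Greatest-mono (≐-sym P≐Q)

    LeftEndpoint-cong : LeftEndpoint I P ≐ LeftEndpoint I Q
    LeftEndpoint-cong = LeftEndpoint-mono P≐Q , LeftEndpoint-mono (≐-sym P≐Q)

    RightEndpoint-cong : RightEndpoint I P ≐ RightEndpoint I Q
    RightEndpoint-cong = RightEndpoint-mono P≐Q , RightEndpoint-mono (≐-sym P≐Q)

  endpoints-of : ∀ {n} → Vector (IntervalUnion I) n → Fin n × Fin 2 → FinSet I
  endpoints-of xs (j , i) = endpoints I (xs j) i

  Value : ∀ f → Vector (IntervalUnion I) (suc (arity signatureL f)) → Pred Carrier _
  Value f xs z = Holds (value f nothing) (endpoints-of xs) (maybe′ ⊥-elim z)

  -- Each operation comes with a pointwise specification. Rewriting membership in its arguments by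
  -- `∈-Between` gives what `value` unfolds to. For `origin`, the points below every point are
  -- exactly those equal to `0#`.
  value-∈ : ∀ f x₀ xs → ⟦_⟧ˡ I (opL f xs) ≐ Value f (x₀ Vector.∷ xs)
  value-∈ union  x₀ xs = ≐-trans (proj₂ (unionL I (xs 0F) (xs 1F)))
    ( Sum.map (proj₁ (∈-Between (xs 0F))) (proj₁ (∈-Between (xs 1F)))
    , Sum.map (proj₂ (∈-Between (xs 0F))) (proj₂ (∈-Between (xs 1F))))
  value-∈ inter  x₀ xs = ≐-trans (proj₂ (interL I (xs 0F) (xs 1F)))
    ( Product.map (proj₁ (∈-Between (xs 0F))) (proj₁ (∈-Between (xs 1F)))
    , Product.map (proj₂ (∈-Between (xs 0F))) (proj₂ (∈-Between (xs 1F))))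
  value-∈ empty  x₀ xs = (λ ()) , λ x<x → contradiction x<x (<.irrefl Eq.refl)
  value-∈ origin x₀ xs = ≐-trans (proj₂ (originL I))
    ( (λ x≈0 y → ≤-respˡ-≈ (Eq.sym x≈0) (0#-minimum y))
    , (λ least → antisym (least 0#) (0#-minimum _)))
  value-∈ min    x₀ xs = ≐-trans (proj₂ (points I (proj₁ (minL I (xs 0F)))))
    (≐-trans (proj₂ (minL I (xs 0F))) (Least-cong (∈-Between (xs 0F))))
  value-∈ max    x₀ xs = ≐-trans (proj₂ (points I (proj₁ (maxL I (xs 0F)))))
    (≐-trans (proj₂ (maxL I (xs 0F))) (Greatest-cong (∈-Between (xs 0F))))
  value-∈ left   x₀ xs = ≐-trans (proj₂ (points I (l (xs 0F))))
    (≐-trans (l-∈ (xs 0F)) (LeftEndpoint-cong (∈-Between (xs 0F))))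
  value-∈ right  x₀ xs = ≐-trans (proj₂ (points I (r (xs 0F))))
    (≐-trans (r-∈ (xs 0F)) (RightEndpoint-cong (∈-Between (xs 0F))))

  ∀⇔ : ∀ {p q} {P : Pred Carrier p} {Q : Pred Carrier q} →
       (∀ x → (P x → Q x) × (Q x → P x)) ⇔ (P ≐ Q)
  ∀⇔ = mk⇔ (λ h → (λ {x} → proj₁ (h x)) , (λ {x} → proj₂ (h x)))
            (λ (f , g) x → f {x} , g {x})

  -- `∈-Between` reconstructs a union from its two endpoint sets.
  coord-injective : ∀ {A B} → (∀ i → endpoints I A i ≈ʷ endpoints I B i) → A ≈ˡ B
  coord-injective {A} {B} e = ≐-trans (∈-Between A)
    (≐-trans (Between-cong {l A} {l B} {r A} {r B} (e 0F) (e 1F)) (≐-sym (∈-Between B)))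

  coord-cong : ∀ {A B} → A ≈ˡ B → ∀ i → endpoints I A i ≈ʷ endpoints I B i
  coord-cong {A} {B} e 0F = ≐-trans (l-∈ A) (≐-trans (LeftEndpoint-cong e) (≐-sym (l-∈ B)))
  coord-cong {A} {B} e 1F = ≐-trans (r-∈ A) (≐-trans (RightEndpoint-cong e) (≐-sym (r-∈ B)))

  -- Forwards, the union supplied by `Between-union` is the preimage, as the formula says that its
  -- endpoints form the given pair. Backwards, the set determined by the endpoints of `A` is `A`
  -- again.
  domain′-holds : ∀ as → Holds domain′ as ⊥-elim ⇔ (∃[ A ] ∀ i → endpoints I A i ≈ʷ as i)
  domain′-holds as = mk⇔
    (λ (hl , hr) →
      let A , A≐ = Between-union (as 0F) (as 1F) in
      A , λ { 0F → ≐-trans (l-∈ A) (≐-trans (LeftEndpoint-cong A≐) (≐-sym (to ∀⇔ hl)))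
            ; 1F → ≐-trans (r-∈ A) (≐-trans (RightEndpoint-cong A≐) (≐-sym (to ∀⇔ hr))) })
    (λ (A , e) →
      let A≐ = ≐-trans (∈-Between A) (Between-cong {l A} {as 0F} {r A} {as 1F} (e 0F) (e 1F)) in
      from ∀⇔ (≐-trans (≐-sym (e 0F)) (≐-trans (l-∈ A) (LeftEndpoint-cong A≐))) ,
      from ∀⇔ (≐-trans (≐-sym (e 1F)) (≐-trans (r-∈ A) (RightEndpoint-cong A≐))))

  equality′-holds : ∀ xs → Holds equality′ (endpoints-of xs) ⊥-elim ⇔ (xs 0F ≈ˡ xs 1F)
  equality′-holds xs = mk⇔
    (λ h → ≐-trans (∈-Between (xs 0F)) (≐-trans (to ∀⇔ h) (≐-sym (∈-Between (xs 1F)))))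
    (λ e → from ∀⇔ (≐-trans (≐-sym (∈-Between (xs 0F))) (≐-trans e (∈-Between (xs 1F)))))

  graph′-holds : ∀ f x₀ xs →
    Holds (graph′ f) (endpoints-of (x₀ Vector.∷ xs)) ⊥-elim ⇔ (opL f xs ≈ˡ x₀)
  graph′-holds f x₀ xs = mk⇔
    (λ h → ≐-trans (value-∈ f x₀ xs) (≐-trans (≐-sym (to ∀⇔ h)) (≐-sym (∈-Between x₀))))
    (λ e → from ∀⇔ (≐-trans (≐-sym (∈-Between x₀)) (≐-trans (≐-sym e) (value-∈ f x₀ xs))))

  sentence-⊨ : ∀ (φ : PointFormula V ⊥) τ → _⊨_ (W I) τ (sentence φ) ⇔ Holds φ τ ⊥-elim
  sentence-⊨ φ τ = translate-⊨ φ {id} {⊥-elim} {τ} λ ()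

theorem6p4 : ∀ {c ℓ₁ ℓ₂} (I : LeftEndpointDLO c ℓ₁ ℓ₂) →
    Interpretation (L I) (W I) (endpoints I)
theorem6p4 I = record
  { coord-cong      = λ {A} {B} → coord-cong I {A} {B}
  ; coord-injective = λ {A} {B} → coord-injective I {A} {B}
  ; domain          = sentence domain′
  ; domain-⊨        = λ as → domain′-holds I as ⇔-∘ sentence-⊨ I domain′ as
  ; equality        = sentence equality′
  ; equality-⊨      = λ xs → equality′-holds I xs ⇔-∘ sentence-⊨ I equality′ (endpoints-of I xs)
  ; graph           = λ f → sentence (graph′ f)
  ; graph-⊨         = λ f x₀ xs →
      graph′-holds I f x₀ xs ⇔-∘ sentence-⊨ I (graph′ f) (endpoints-of I (x₀ Vector.∷ xs))
  }
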